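{- Let $\lambda=(\lambda_1,\dots,\lambda_n)$ be an integer partition, $\lambda_1\ge\cdots\ge\lambda_n\ge 0$, and set $\lambda_{n+1}=0$. Let $$\Omega_n(\lambda)=\prod_{i=1}^n\left(x_1+x_2+\cdots+x_{\lambda_i}\right)$$ and let $N(\Omega_n(\lambda))$ be the number of distinct monomials in this product. (a) We have $$N(\Omega_n(\lambda))=\sum_{(k_1,\dots,k_n)\in K_n}\ \prod_{i=1}^n\left(\!\!\binom{\lambda_i-\lambda_{i+1}}{k_i}\!\!\right),$$ where $K_n=\{(k_1,\dots,k_n)\in\mathbb{N}^n:\ k_1+\cdots+k_i\le i\text{ for }1\le i\le n,\ \sum_{j=1}^n k_j=n\}$. (b) For $1\le i\le n$ such that $(\lambda_1,\dots,\lambda_{i-1},\lambda_i+1,\lambda_{i+1},\dots,\lambda_n)$ is again a partition, $$N(\Omega_n(\lambda_1,\dots,\lambda_{i-1},\lambda_i+1,\lambda_{i+1},\dots,\lambda_n))=N(\Omega_n(\lambda_1,\dots,\lambda_n))+N(\Omega_i(\lambda_1-\lambda_i,\dots,\lambda_{i-1}-\lambda_i,1))\cdot N(\Omega_{n-i}(\lambda_{i+1},\dots,\lambda_n)).$$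
   Context: $\mathbb{N}=\{0,1,2,\dots\}$. The products are polynomials with integer coefficients; the number of distinct monomials is the number of nonzero coefficients. An empty sum $x_1+\cdots+x_0$ is $0$ (so the product is then $0$ and has no monomials), and the empty product is $\Omega_0=1$, with $N(\Omega_0)=1$. The symbol $\left(\!\binom{r}{s}\!\right)=\binom{r+s-1}{s}$ is the number of $s$-combinations of an $r$-element set allowing repetition; in particular $\left(\!\binom{0}{0}\!\right)=1$ and $\left(\!\binom{0}{s}\!\right)=0$ for $s\ge 1$. -}

module Defs where

open import Data.Nat using (ℕ; zero; suc; _+_; _*_; _∸_; _⊔_; _≤_; _≥_; _≟_; _≤?_; _<?_)
open import Data.Nat.Combinatorics using (_C_)
import Data.Nat.ListAction as ListAction
open import Data.Integer as ℤ using (ℤ; 0ℤ; 1ℤ)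
open import Data.Fin using (Fin; zero; suc; toℕ)
open import Data.Fin.Properties using (all?)
open import Data.List as List
  using (List; []; _∷_; _++_; map; filter; deduplicate; cartesianProductWith; allFin; upTo; length)
open import Data.Product using (_×_; _,_; proj₁; proj₂)
open import Data.Vec as Vec using (Vec; []; _∷_; _∷ʳ_; lookup; replicate; zipWith; _[_]≔_)
open import Data.Vec.Properties using (≡-dec)
open import Data.Vec.Relation.Unary.Linked using (Linked)
open import Relation.Binary.Definitions using (DecidableEquality)
open import Relation.Binary.PropositionalEquality using (_≡_)
open import Relation.Nullary using (Dec; ¬?; _×-dec_)

-- Polynomials in ℤ[x₁,…,xₘ].  A polynomial is presented as a formal sum of
-- terms c·x^α, in which the same exponent vector α may occur several times;
-- its coefficient at α is the sum of the corresponding c's.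

Monomial : ℕ → Set
Monomial m = Vec ℕ m

_≟ᵐ_ : ∀ {m} → DecidableEquality (Monomial m)
_≟ᵐ_ = ≡-dec _≟_

Poly : ℕ → Set
Poly m = List (ℤ × Monomial m)

coeff : ∀ {m} → Poly m → Monomial m → ℤ
coeff p α = List.foldr ℤ._+_ 0ℤ (map proj₁ (filter (λ t → proj₂ t ≟ᵐ α) p))

support : ∀ {m} → Poly m → List (Monomial m)
support p =
  filter (λ α → ¬? (coeff p α ℤ.≟ 0ℤ)) (deduplicate _≟ᵐ_ (map proj₂ p))

#monomials : ∀ {m} → Poly m → ℕ
#monomials p = length (support p)

0ᵖ 1ᵖ : ∀ {m} → Poly m
0ᵖ = []
1ᵖ = (1ℤ , replicate _ 0) ∷ []

infixl 6 _+ᵖ_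
infixl 7 _*ᵗ_ _*ᵖ_

_*ᵗ_ : ∀ {m} → ℤ × Monomial m → ℤ × Monomial m → ℤ × Monomial m
(c , α) *ᵗ (d , β) = c ℤ.* d , zipWith _+_ α β

_+ᵖ_ _*ᵖ_ : ∀ {m} → Poly m → Poly m → Poly m
p +ᵖ q = p ++ q
p *ᵖ q = cartesianProductWith _*ᵗ_ p q

-- Indices start at 0: var i is x_{i+1}.
var : ∀ {m} → Fin m → Poly m
var i = (1ℤ , replicate _ 0 [ i ]≔ 1) ∷ []

-- x₁ + ⋯ + x_r; only used for r ≤ m.
x₁+⋯+x : ∀ {m} → ℕ → Poly m
x₁+⋯+x {m} r = List.foldr _+ᵖ_ 0ᵖ (map var (filter (λ i → toℕ i <? r) (allFin m)))

IsPartition : ∀ {n} → Vec ℕ n → Set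
IsPartition = Linked _≥_

maxPart : ∀ {n} → Vec ℕ n → ℕ
maxPart = Vec.foldr′ _⊔_ 0

-- The ambient ring has exactly the variables x₁,…,x_m with m the largest part,
-- so that every factor x₁ + ⋯ + x_{λᵢ} lies in it.
Ω : ∀ n (μ : Vec ℕ n) → Poly (maxPart μ)
Ω n μ = Vec.foldr′ _*ᵖ_ 1ᵖ (Vec.map x₁+⋯+x μ)

N : ∀ n → Vec ℕ n → ℕ
N n μ = #monomials (Ω n μ)

-- The multiset coefficient.  The subtraction truncates only for r = s = 0,
-- where 0 C 0 = 1 is the required value.
multichoose : ℕ → ℕ → ℕ
multichoose r s = (r + s ∸ 1) C s

product : ∀ {n} → Vec ℕ n → ℕ
product = Vec.foldr′ _*_ 1

before : ∀ {A : Set} {n} → Vec A n → (i : Fin n) → Vec A (toℕ i)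
before (x ∷ xs) zero    = []
before (x ∷ xs) (suc i) = x ∷ before xs i

after : ∀ {A : Set} {n} → Vec A n → (i : Fin n) → Vec A (n ∸ suc (toℕ i))
after (x ∷ xs) zero    = xs
after (x ∷ xs) (suc i) = after xs i

InK : ∀ n → Vec ℕ n → Set
InK n k = (∀ i → Vec.sum (before k i ∷ʳ lookup k i) ≤ suc (toℕ i)) × Vec.sum k ≡ n

inK? : ∀ n (k : Vec ℕ n) → Dec (InK n k)
inK? n k =
  all? (λ i → Vec.sum (before k i ∷ʳ lookup k i) ≤? suc (toℕ i)) ×-dec (Vec.sum k ≟ n)

vectorsBelow : ℕ → ∀ n → List (Vec ℕ n)
vectorsBelow b zero    = [] ∷ []
vectorsBelow b (suc n) = cartesianProductWith _∷_ (upTo b) (vectorsBelow b n)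

-- All k satisfying InK n, each listed once: the entries of such a k sum to n,
-- so none of them exceeds n.
K : ∀ n → List (Vec ℕ n)
K n = filter (inK? n) (vectorsBelow (suc n) n)

∑K : ∀ n → (Vec ℕ n → ℕ) → ℕ
∑K n f = ListAction.sum (map f (K n))

{-# OPTIONS --safe #-}

-- Multiplying Ω(λ) by (x₁+⋯+x_{λ₁})ˢ gives a count W λ s that can be computed one
-- variable at a time: the exponent t of the last variable may be anything with t ≤ s
-- and leaves slack s − t for the other variables, so a further variable replaces
-- f by its partial sums s ↦ f 0 + ⋯ + f s; a further part λ₀ ≥ λ₁ raises the slack
-- by one once the variables up to x_{λ₀} have been added.
--
-- (a) The d-fold partial sums of f are its convolution with multichoose d (Pascal),
-- and unrolling W λ 0 gives the sum over K.
--
-- (b) By Σ≤ f (s + 1) = Σ≤ (f ∘ suc) s + f 0, adding 1 to λᵢ turns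
-- g = W (λᵢ,…,λ_n) into Σ≤ g + c with c = N(Ω(λ_{i+1},…,λ_n)).  The partial sum in
-- Σ≤ g makes up for the variable fewer that λ_{i-1} adds afterwards, so that this term
-- yields W λ; the constant function 1 is W (1), from which the same steps yield
-- W (λ₁−λᵢ,…,λ_{i-1}−λᵢ,1).  All steps are linear.
module Submission where

open import Defs
open import Data.Fin using (Fin; zero; suc; toℕ; fromℕ; inject₁)
open import Data.Fin.Properties using (all?; toℕ-inject₁; toℕ-fromℕ; toℕ<n; fromℕ≢inject₁)
open import Data.Fin.Relation.Unary.Top using (view; ‵fromℕ; ‵inject₁)
open import Data.Integer as ℤ using (ℤ; 0ℤ; 1ℤ)
open import Data.List as List
  using (List; []; _∷_; _++_; length; filter; cartesianProductWith; applyUpTo; upTo)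
open import Data.List.Membership.Propositional using (_∈_)
open import Data.List.Membership.Propositional.Properties
open import Data.List.Membership.Propositional.Properties.WithK using (unique∧set⇒bag)
open import Data.List.Properties
  using (filter-++; filter-≐; filter-none; map-++; map-upTo; length-map; length-++)
open import Data.List.Relation.Binary.BagAndSetEquality using (∼bag⇒↭)
open import Data.List.Relation.Binary.Permutation.Propositional.Properties using (↭-length)
open import Data.List.Relation.Unary.All as All using (All; []; _∷_)
open import Data.List.Relation.Unary.AllPairs using ([]; _∷_)
open import Data.List.Relation.Unary.Any using (here)
open import Data.List.Relation.Unary.Unique.DecPropositional.Properties using (deduplicate-!)
open import Data.List.Relation.Unary.Unique.Propositional using (Unique)
import Data.List.Relation.Unary.Unique.Propositional.Properties as Unique
open import Data.Nat
  using (ℕ; zero; suc; _+_; _*_; _∸_; _≤_; _<_; z≤n; s≤s; _≤?_; _<?_; _≟_)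
open import Data.Nat.Combinatorics using (_C_; nCk+nC[k+1]≡[n+1]C[k+1]; k>n⇒nCk≡0)
open import Data.Nat.ListAction using (sum)
open import Data.Nat.ListAction.Properties using (sum-++)
open import Data.Nat.Properties hiding (_≤?_; _<?_; _≟_)
open import Data.Nat.Solver using (module +-*-Solver)
open import Data.Product using (∃; _×_; _,_; proj₁; proj₂)
open import Data.Sum as Sum using (_⊎_; inj₁; inj₂)
open import Data.Vec as Vec
  using (Vec; []; _∷_; lookup; tabulate; map; updateAt; _∷ʳ_; replicate; zipWith; _[_]≔_)
open import Data.Vec.Properties
  using (updateAt-commutes; lookup∘updateAt; ∷ʳ-injectiveˡ; ∷-injective; zipWith-identityˡ)
open import Data.Vec.Relation.Unary.Linked as Linked using ([]; [-]; _∷_)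
open import Function using (_∘_; _⇔_; mk⇔; Injective)
open import Function.Bundles using (module Equivalence)
open import Function.Construct.Composition using (_⇔-∘_)
open import Function.Construct.Symmetry using (⇔-sym)
open import Relation.Binary.PropositionalEquality
open import Relation.Nullary using (¬_; yes; no; _×-dec_; contradiction)
open import Relation.Unary using (Decidable)

open Equivalence

-- Partial sums

δ : ℕ → ℕ
δ zero    = 1
δ (suc _) = 0

Σ≤ : (ℕ → ℕ) → ℕ → ℕ
Σ≤ f zero    = f zero
Σ≤ f (suc s) = f (suc s) + Σ≤ f s

Σ≤^ : ℕ → (ℕ → ℕ) → ℕ → ℕ
Σ≤^ zero    f = f
Σ≤^ (suc d) f = Σ≤ (Σ≤^ d f)

Σ≤-cong : ∀ {f g} → f ≗ g → Σ≤ f ≗ Σ≤ g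
Σ≤-cong f≗g zero    = f≗g zero
Σ≤-cong f≗g (suc s) = cong₂ _+_ (f≗g (suc s)) (Σ≤-cong f≗g s)

Σ≤^-cong : ∀ d {f g} → f ≗ g → Σ≤^ d f ≗ Σ≤^ d g
Σ≤^-cong zero    f≗g = f≗g
Σ≤^-cong (suc d) f≗g = Σ≤-cong (Σ≤^-cong d f≗g)

Σ≤^-Σ≤ : ∀ d f → Σ≤^ d (Σ≤ f) ≗ Σ≤^ (suc d) f
Σ≤^-Σ≤ zero    f s = refl
Σ≤^-Σ≤ (suc d) f s = Σ≤-cong (Σ≤^-Σ≤ d f) s

Σ≤^-zero : ∀ d f → Σ≤^ d f 0 ≡ f 0
Σ≤^-zero zero    f = refl
Σ≤^-zero (suc d) f = Σ≤^-zero d f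

Σ≤-linear : ∀ f c g s → Σ≤ (λ t → f t + c * g t) s ≡ Σ≤ f s + c * Σ≤ g s
Σ≤-linear f c g zero    = refl
Σ≤-linear f c g (suc s) = begin
  f (suc s) + c * g (suc s) + Σ≤ (λ t → f t + c * g t) s
    ≡⟨ cong (f (suc s) + c * g (suc s) +_) (Σ≤-linear f c g s) ⟩
  f (suc s) + c * g (suc s) + (Σ≤ f s + c * Σ≤ g s)
    ≡⟨ solve 5 (λ a c b u v → a :+ c :* b :+ (u :+ c :* v) := a :+ u :+ c :* (b :+ v))
         refl (f (suc s)) c (g (suc s)) (Σ≤ f s) (Σ≤ g s) ⟩
  f (suc s) + Σ≤ f s + c * (g (suc s) + Σ≤ g s) ∎
  where open ≡-Reasoning; open +-*-Solver

Σ≤^-linear : ∀ d f c g s → Σ≤^ d (λ t → f t + c * g t) s ≡ Σ≤^ d f s + c * Σ≤^ d g s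
Σ≤^-linear zero    f c g s = refl
Σ≤^-linear (suc d) f c g s =
  trans (Σ≤-cong (Σ≤^-linear d f c g) s) (Σ≤-linear (Σ≤^ d f) c (Σ≤^ d g) s)

Σ≤-shift : ∀ f s → Σ≤ f (suc s) ≡ Σ≤ (f ∘ suc) s + f 0
Σ≤-shift f zero    = refl
Σ≤-shift f (suc s) = trans (cong (f (suc (suc s)) +_) (Σ≤-shift f s))
                          (sym (+-assoc (f (suc (suc s))) _ _))

-- This is what makes the constant function 1 equal to `W (1 ∷ [])`.
Σ≤-δ : ∀ s → Σ≤ δ s ≡ 1
Σ≤-δ zero    = refl
Σ≤-δ (suc s) = Σ≤-δ s

-- W μ s counts the monomials of (x₁+⋯+x_{μ₁})ˢ Ω(μ).
W : ∀ {n} → Vec ℕ n → ℕ → ℕ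
W []      s = δ s
W (a ∷ μ) s = Σ≤^ (a ∸ maxPart μ) (W μ) (suc s)

-- Enlarging one part of a partition

maxPart≤ : ∀ {n a} {μ : Vec ℕ n} → IsPartition (a ∷ μ) → maxPart μ ≤ a
maxPart≤ [-]       = z≤n
maxPart≤ {μ = _ ∷ _} (a≥b ∷ p) = ⊔-lub a≥b (≤-trans (maxPart≤ p) a≥b)

maxPart-∷ : ∀ {n a} {μ : Vec ℕ n} → IsPartition (a ∷ μ) → maxPart (a ∷ μ) ≡ a
maxPart-∷ p = m≥n⇒m⊔n≡m (maxPart≤ p)

-- The partition (λ₁ - λᵢ, ..., λ_{i-1} - λᵢ, 1) of part (b).
cut : ∀ {n} (μ : Vec ℕ n) (i : Fin n) → Vec ℕ (suc (toℕ i))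
cut μ i = map (λ a → a ∸ lookup μ i) (before μ i) ∷ʳ 1

-- That λᵢ may grow by one means λ_{i-1} > λᵢ, so the last difference is at least the final 1.
cut-isPartition : ∀ {n} {μ : Vec ℕ n} (i : Fin n) → IsPartition μ →
  IsPartition (updateAt μ i suc) → IsPartition (cut μ i)
cut-isPartition {μ = _ ∷ _} zero p q = [-]
cut-isPartition {μ = _ ∷ b ∷ _} (suc zero) (_ ∷ p) (a>b ∷ q) = m<n⇒0<n∸m a>b ∷ [-]
cut-isPartition {μ = _ ∷ _ ∷ μ} (suc (suc i)) (a≥b ∷ p) (_ ∷ q) =
  ∸-monoˡ-≤ (lookup μ i) a≥b ∷ cut-isPartition {μ = _ ∷ μ} (suc i) p q

after-isPartition : ∀ {n} {μ : Vec ℕ n} (i : Fin n) → IsPartition μ → IsPartition (after μ i)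
after-isPartition {μ = _ ∷ _} zero    p = Linked.tail p
after-isPartition {μ = _ ∷ _} (suc i) p = after-isPartition i (Linked.tail p)

-- The larger head costs one more partial sum, and `Σ≤-shift` splits off its term at 0, which is
-- `W μ 0`. Reading this constant as a multiple of `W (1 ∷ [])` starts the recursion for the second
-- product.
W-suc-head : ∀ {n a} {μ : Vec ℕ n} → IsPartition (a ∷ μ) → ∀ s →
  W (suc a ∷ μ) s ≡ Σ≤ (W (a ∷ μ)) s + W μ 0 * W (1 ∷ []) s
W-suc-head {a = a} {μ} p s = begin
  Σ≤^ (suc a ∸ maxPart μ) (W μ) (suc s)
    ≡⟨ cong (λ d → Σ≤^ d (W μ) (suc s)) (+-∸-assoc 1 (maxPart≤ p)) ⟩
  Σ≤ (Σ≤^ (a ∸ maxPart μ) (W μ)) (suc s)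
    ≡⟨ Σ≤-shift (Σ≤^ (a ∸ maxPart μ) (W μ)) s ⟩
  Σ≤ (W (a ∷ μ)) s + Σ≤^ (a ∸ maxPart μ) (W μ) 0
    ≡⟨ cong (Σ≤ (W (a ∷ μ)) s +_) (Σ≤^-zero (a ∸ maxPart μ) (W μ)) ⟩
  Σ≤ (W (a ∷ μ)) s + W μ 0
    ≡⟨ cong (Σ≤ (W (a ∷ μ)) s +_) (sym (*-identityʳ (W μ 0))) ⟩
  Σ≤ (W (a ∷ μ)) s + W μ 0 * 1
    ≡⟨ cong (λ c → Σ≤ (W (a ∷ μ)) s + W μ 0 * c) (sym (Σ≤-δ s)) ⟩
  Σ≤ (W (a ∷ μ)) s + W μ 0 * W (1 ∷ []) s ∎
  where open ≡-Reasoning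

-- Generalised to x variables and slack s, so that the induction can pass through the parts before
-- position i. In the correction term all variable counts are lowered by λᵢ.
Σ≤^-W-updateAt : ∀ {n} {μ : Vec ℕ n} (i : Fin n) → IsPartition μ →
  IsPartition (updateAt μ i suc) → ∀ x → maxPart (updateAt μ i suc) ≤ x → ∀ s →
  Σ≤^ (x ∸ maxPart (updateAt μ i suc)) (W (updateAt μ i suc)) s
    ≡ Σ≤^ (x ∸ maxPart μ) (W μ) s
      + W (after μ i) 0 * Σ≤^ (x ∸ lookup μ i ∸ maxPart (cut μ i)) (W (cut μ i)) s
Σ≤^-W-updateAt {μ = a ∷ μ} zero p q x m≤x s
  rewrite maxPart-∷ p | maxPart-∷ q = begin
  Σ≤^ (x ∸ suc a) (W (suc a ∷ μ)) s
    ≡⟨ Σ≤^-cong (x ∸ suc a) (W-suc-head p) s ⟩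
  Σ≤^ (x ∸ suc a) (λ t → Σ≤ (W (a ∷ μ)) t + W μ 0 * W (1 ∷ []) t) s
    ≡⟨ Σ≤^-linear (x ∸ suc a) (Σ≤ (W (a ∷ μ))) (W μ 0) (W (1 ∷ [])) s ⟩
  Σ≤^ (x ∸ suc a) (Σ≤ (W (a ∷ μ))) s + W μ 0 * Σ≤^ (x ∸ suc a) (W (1 ∷ [])) s
    ≡⟨ cong₂ (λ u d → u + W μ 0 * Σ≤^ d (W (1 ∷ [])) s)
         (trans (Σ≤^-Σ≤ (x ∸ suc a) (W (a ∷ μ)) s)
                (cong (λ d → Σ≤^ d (W (a ∷ μ)) s) (sym (+-∸-assoc 1 m≤x))))
         (trans (cong (x ∸_) (+-comm 1 a)) (sym (∸-+-assoc x a 1))) ⟩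
  Σ≤^ (x ∸ a) (W (a ∷ μ)) s + W μ 0 * Σ≤^ (x ∸ a ∸ 1) (W (1 ∷ [])) s ∎
  where open ≡-Reasoning
Σ≤^-W-updateAt {μ = a ∷ μ} (suc i) p q x m≤x s
  rewrite maxPart-∷ p | maxPart-∷ q | maxPart-∷ (cut-isPartition (suc i) p q) = begin
  Σ≤^ (x ∸ a) (W (a ∷ updateAt μ i suc)) s
    -- With a variables and slack `suc t`, the two terms of the induction hypothesis fold back into
    -- `W` with the new heads a and `a ∸ lookup μ i`.
    ≡⟨ Σ≤^-cong (x ∸ a) (λ t → Σ≤^-W-updateAt i (Linked.tail p) (Linked.tail q) a (maxPart≤ q) (suc t)) s ⟩
  Σ≤^ (x ∸ a) (λ t → W (a ∷ μ) t + c * W (cut (a ∷ μ) (suc i)) t) s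
    ≡⟨ Σ≤^-linear (x ∸ a) (W (a ∷ μ)) c (W (cut (a ∷ μ) (suc i))) s ⟩
  Σ≤^ (x ∸ a) (W (a ∷ μ)) s + c * Σ≤^ (x ∸ a) (W (cut (a ∷ μ) (suc i))) s
    ≡⟨ cong (λ d → Σ≤^ (x ∸ a) (W (a ∷ μ)) s + c * Σ≤^ d (W (cut (a ∷ μ) (suc i))) s) (sym x∸b∸[a∸b]≡x∸a) ⟩
  Σ≤^ (x ∸ a) (W (a ∷ μ)) s + c * Σ≤^ (x ∸ b ∸ (a ∸ b)) (W (cut (a ∷ μ) (suc i))) s ∎
  where
  open ≡-Reasoning
  c = W (after μ i) 0
  b = lookup μ i
  lookup≤ : ∀ {n} (ν : Vec ℕ n) j → lookup ν j ≤ maxPart ν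
  lookup≤ (y ∷ ν) zero    = m≤m⊔n y _
  lookup≤ (y ∷ ν) (suc j) = ≤-trans (lookup≤ ν j) (m≤n⊔m y _)
  x∸b∸[a∸b]≡x∸a : x ∸ b ∸ (a ∸ b) ≡ x ∸ a
  x∸b∸[a∸b]≡x∸a = trans (∸-+-assoc x b (a ∸ b))
    (cong (x ∸_) (m+[n∸m]≡n (≤-trans (lookup≤ μ i) (maxPart≤ p))))

-- Partial sums do not change the value at 0, so at slack 0 the number of variables drops out.
W-updateAt : ∀ {n} {μ : Vec ℕ n} (i : Fin n) → IsPartition μ → IsPartition (updateAt μ i suc) →
  W (updateAt μ i suc) 0 ≡ W μ 0 + W (cut μ i) 0 * W (after μ i) 0
W-updateAt {μ = μ} i p q = begin
  W μ′ 0
    ≡⟨ Σ≤^-zero (m ∸ maxPart μ′) (W μ′) ⟨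
  Σ≤^ (m ∸ maxPart μ′) (W μ′) 0
    ≡⟨ Σ≤^-W-updateAt i p q m ≤-refl 0 ⟩
  Σ≤^ (m ∸ maxPart μ) (W μ) 0 + W (after μ i) 0 * Σ≤^ d (W (cut μ i)) 0
    ≡⟨ cong₂ (λ u v → u + W (after μ i) 0 * v) (Σ≤^-zero (m ∸ maxPart μ) (W μ)) (Σ≤^-zero d (W (cut μ i))) ⟩
  W μ 0 + W (after μ i) 0 * W (cut μ i) 0
    ≡⟨ cong (W μ 0 +_) (*-comm (W (after μ i) 0) (W (cut μ i) 0)) ⟩
  W μ 0 + W (cut μ i) 0 * W (after μ i) 0 ∎
  where
  open ≡-Reasoning
  μ′ = updateAt μ i suc
  m = maxPart μ′
  d = m ∸ lookup μ i ∸ maxPart (cut μ i)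

-- The sum over K

-- The Cauchy product: the sum of g k · f (s - k) over k ≤ s.
_⋆_ : (ℕ → ℕ) → (ℕ → ℕ) → ℕ → ℕ
(g ⋆ f) zero    = g 0 * f 0
(g ⋆ f) (suc s) = g 0 * f (suc s) + ((g ∘ suc) ⋆ f) s

⋆-congˡ : ∀ {g h} f → g ≗ h → (g ⋆ f) ≗ (h ⋆ f)
⋆-congˡ f g≗h zero    = cong (_* f 0) (g≗h 0)
⋆-congˡ f g≗h (suc s) = cong₂ _+_ (cong (_* f (suc s)) (g≗h 0)) (⋆-congˡ f (g≗h ∘ suc) s)

⋆-congʳ : ∀ g {f h} → f ≗ h → (g ⋆ f) ≗ (g ⋆ h)
⋆-congʳ g f≗h zero    = cong (g 0 *_) (f≗h 0)
⋆-congʳ g f≗h (suc s) = cong₂ _+_ (cong (g 0 *_) (f≗h (suc s))) (⋆-congʳ (g ∘ suc) f≗h s)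

⋆-distribʳ-+ : ∀ f g h s → ((λ k → g k + h k) ⋆ f) s ≡ (g ⋆ f) s + (h ⋆ f) s
⋆-distribʳ-+ f g h zero    = *-distribʳ-+ (f 0) (g 0) (h 0)
⋆-distribʳ-+ f g h (suc s) = begin
  (g 0 + h 0) * f (suc s) + ((λ k → g (suc k) + h (suc k)) ⋆ f) s
    ≡⟨ cong ((g 0 + h 0) * f (suc s) +_) (⋆-distribʳ-+ f (g ∘ suc) (h ∘ suc) s) ⟩
  (g 0 + h 0) * f (suc s) + (((g ∘ suc) ⋆ f) s + ((h ∘ suc) ⋆ f) s)
    ≡⟨ solve 5 (λ a b c u v → (a :+ b) :* c :+ (u :+ v) := a :* c :+ u :+ (b :* c :+ v))
         refl (g 0) (h 0) (f (suc s)) (((g ∘ suc) ⋆ f) s) (((h ∘ suc) ⋆ f) s) ⟩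
  (g ⋆ f) (suc s) + (h ⋆ f) (suc s) ∎
  where open ≡-Reasoning; open +-*-Solver

-- `Σ≤ g ∘ suc` is by definition the sum of `g ∘ suc` and `Σ≤ g`, so distributivity gives the
-- induction step. For generating functions, this applies the factor 1/(1 - x) to one factor of a
-- product.
Σ≤-⋆ : ∀ g f → Σ≤ (g ⋆ f) ≗ (Σ≤ g ⋆ f)
Σ≤-⋆ g f zero    = refl
Σ≤-⋆ g f (suc s) = begin
  g 0 * f (suc s) + ((g ∘ suc) ⋆ f) s + Σ≤ (g ⋆ f) s
    ≡⟨ cong (g 0 * f (suc s) + ((g ∘ suc) ⋆ f) s +_) (Σ≤-⋆ g f s) ⟩
  g 0 * f (suc s) + ((g ∘ suc) ⋆ f) s + (Σ≤ g ⋆ f) s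
    ≡⟨ +-assoc (g 0 * f (suc s)) _ _ ⟩
  g 0 * f (suc s) + (((g ∘ suc) ⋆ f) s + (Σ≤ g ⋆ f) s)
    ≡⟨ cong (g 0 * f (suc s) +_) (⋆-distribʳ-+ f (g ∘ suc) (Σ≤ g) s) ⟨
  (Σ≤ g ⋆ f) (suc s) ∎
  where open ≡-Reasoning

multichoose-zero : ∀ k → multichoose 0 k ≡ δ k
multichoose-zero zero    = refl
multichoose-zero (suc k) = k>n⇒nCk≡0 (n<1+n k)

multichoose-suc : ∀ d → multichoose (suc d) ≗ Σ≤ (multichoose d)
multichoose-suc d zero    = refl
multichoose-suc d (suc k) = begin
  (d + suc k) C suc k
    ≡⟨ cong (_C suc k) (+-suc d k) ⟩
  suc (d + k) C suc k
    ≡⟨ nCk+nC[k+1]≡[n+1]C[k+1] (d + k) k ⟨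
  (d + k) C k + (d + k) C suc k
    ≡⟨ +-comm ((d + k) C k) _ ⟩
  (d + k) C suc k + (d + k) C k
    ≡⟨ cong₂ _+_ (cong (λ m → (m ∸ 1) C suc k) (sym (+-suc d k))) (multichoose-suc d k) ⟩
  multichoose d (suc k) + Σ≤ (multichoose d) k ∎
  where open ≡-Reasoning

⋆-zeroˡ : ∀ f s → ((λ _ → 0) ⋆ f) s ≡ 0
⋆-zeroˡ f zero    = refl
⋆-zeroˡ f (suc s) = ⋆-zeroˡ f s

⋆-identityˡ : ∀ f → (δ ⋆ f) ≗ f
⋆-identityˡ f zero    = +-identityʳ (f 0)
⋆-identityˡ f (suc s) = begin
  f (suc s) + 0 + ((λ _ → 0) ⋆ f) s ≡⟨ cong₂ _+_ (+-identityʳ (f (suc s))) (⋆-zeroˡ f s) ⟩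
  f (suc s) + 0                     ≡⟨ +-identityʳ (f (suc s)) ⟩
  f (suc s)                         ∎
  where open ≡-Reasoning

-- `multichoose d` arises from the unit `δ` of `⋆` by d partial sums; its generating function is
-- 1/(1 - x)^d.
Σ≤^≗multichoose-⋆ : ∀ d f → Σ≤^ d f ≗ (multichoose d ⋆ f)
Σ≤^≗multichoose-⋆ zero    f s =
  sym (trans (⋆-congˡ f multichoose-zero s) (⋆-identityˡ f s))
Σ≤^≗multichoose-⋆ (suc d) f s = begin
  Σ≤ (Σ≤^ d f) s               ≡⟨ Σ≤-cong (Σ≤^≗multichoose-⋆ d f) s ⟩
  Σ≤ (multichoose d ⋆ f) s    ≡⟨ Σ≤-⋆ (multichoose d) f s ⟩
  (Σ≤ (multichoose d) ⋆ f) s  ≡⟨ ⋆-congˡ f (multichoose-suc d) s ⟨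
  (multichoose (suc d) ⋆ f) s ∎
  where open ≡-Reasoning

sum-applyUpTo-zero : ∀ f b → (∀ x → f x ≡ 0) → sum (applyUpTo f b) ≡ 0
sum-applyUpTo-zero f zero    f≗0 = refl
sum-applyUpTo-zero f (suc b) f≗0 = cong₂ _+_ (f≗0 0) (sum-applyUpTo-zero (f ∘ suc) b (f≗0 ∘ suc))

-- The terms beyond s vanish, so the cutoff b of the enumeration is immaterial once it exceeds s.
sum-applyUpTo-⋆ : ∀ φ g f s b → s < b →
  (∀ {x} → x ≤ s → φ x ≡ g x * f (s ∸ x)) → (∀ {x} → s < x → φ x ≡ 0) →
  sum (applyUpTo φ b) ≡ (g ⋆ f) s
sum-applyUpTo-⋆ φ g f zero (suc b) _ φ≡ φ≡0 =
  trans (cong₂ _+_ (φ≡ z≤n) (sum-applyUpTo-zero (φ ∘ suc) b (λ x → φ≡0 (s≤s z≤n)))) (+-identityʳ _)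
sum-applyUpTo-⋆ φ g f (suc s) (suc b) (s≤s s<b) φ≡ φ≡0 =
  cong₂ _+_ (φ≡ z≤n) (sum-applyUpTo-⋆ (φ ∘ suc) (g ∘ suc) f s b s<b (φ≡ ∘ s≤s) (φ≡0 ∘ s≤s))

-- K with slack: InKˢ 0 is InK, and removing the first entry from a member of
-- InKˢ s leaves a member of InKˢ for another slack.
InKˢ : ℕ → ∀ n → Vec ℕ n → Set
InKˢ s n k = (∀ i → Vec.sum (before k i ∷ʳ lookup k i) ≤ s + suc (toℕ i)) × Vec.sum k ≡ s + n

inKˢ? : ∀ s n → Decidable (InKˢ s n)
inKˢ? s n k =
  all? (λ i → Vec.sum (before k i ∷ʳ lookup k i) ≤? s + suc (toℕ i)) ×-dec (Vec.sum k ≟ s + n)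

InKˢ-head≤ : ∀ {s n x} {k : Vec ℕ n} → InKˢ s (suc n) (x ∷ k) → x ≤ suc s
InKˢ-head≤ {s} (pre , _) = subst₂ _≤_ (+-identityʳ _) (+-comm s 1) (pre zero)

private
  -- Removing a first entry x uses up x of the slack, while the position removed gives one back:
  -- `suc s ∸ x` remains.
  slack-∷ : ∀ {s x} m → x ≤ suc s → x + (suc s ∸ x + m) ≡ s + suc m
  slack-∷ {s} {x} m x≤ = begin
    x + (suc s ∸ x + m) ≡⟨ +-assoc x _ m ⟨
    x + (suc s ∸ x) + m ≡⟨ cong (_+ m) (m+[n∸m]≡n x≤) ⟩
    suc s + m           ≡⟨ +-suc s m ⟨
    s + suc m           ∎
    where open ≡-Reasoning

InKˢ-tail : ∀ {s n x} {k : Vec ℕ n} → x ≤ suc s →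
  InKˢ s (suc n) (x ∷ k) → InKˢ (suc s ∸ x) n k
InKˢ-tail {s} {n} {x} x≤ (pre , total) =
  (λ i → +-cancelˡ-≤ x _ _ (≤-trans (pre (suc i)) (≤-reflexive (sym (slack-∷ (suc (toℕ i)) x≤))))) ,
  +-cancelˡ-≡ x _ _ (trans total (sym (slack-∷ n x≤)))

InKˢ-∷ : ∀ {s n x} {k : Vec ℕ n} → x ≤ suc s →
  InKˢ (suc s ∸ x) n k → InKˢ s (suc n) (x ∷ k)
InKˢ-∷ {s} {n} {x} x≤ (pre , total) = prefixes , trans (cong (x +_) total) (slack-∷ n x≤)
  where
  prefixes : ∀ i → _
  prefixes zero    = subst₂ _≤_ (sym (+-identityʳ _)) (+-comm 1 s) x≤
  prefixes (suc i) = ≤-trans (+-monoʳ-≤ x (pre i)) (≤-reflexive (slack-∷ (suc (toℕ i)) x≤))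

module _ {A : Set} where

  ∑ : (A → ℕ) → List A → ℕ
  ∑ f xs = sum (List.map f xs)

  ∑-++ : ∀ f xs ys → ∑ f (xs ++ ys) ≡ ∑ f xs + ∑ f ys
  ∑-++ f xs ys = trans (cong sum (map-++ f xs ys)) (sum-++ (List.map f xs) (List.map f ys))

  ∑-*ˡ : ∀ c f xs → ∑ (λ x → c * f x) xs ≡ c * ∑ f xs
  ∑-*ˡ c f []       = sym (*-zeroʳ c)
  ∑-*ˡ c f (x ∷ xs) = trans (cong (c * f x +_) (∑-*ˡ c f xs)) (sym (*-distribˡ-+ c (f x) _))

∑-filter-map : ∀ {A B : Set} {P : B → Set} (P? : Decidable P) (f : B → ℕ) (g : A → B) xs →
  ∑ f (filter P? (List.map g xs)) ≡ ∑ (f ∘ g) (filter (P? ∘ g) xs)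
∑-filter-map P? f g [] = refl
∑-filter-map P? f g (x ∷ xs) with P? (g x)
... | yes _ = cong (f (g x) +_) (∑-filter-map P? f g xs)
... | no  _ = ∑-filter-map P? f g xs

∑-filter-cartesianProductWith : ∀ {A B X : Set} {P : X → Set} (P? : Decidable P)
  (f : X → ℕ) (g : A → B → X) xs ys →
  ∑ f (filter P? (cartesianProductWith g xs ys))
    ≡ ∑ (λ x → ∑ (f ∘ g x) (filter (P? ∘ g x) ys)) xs
∑-filter-cartesianProductWith P? f g []       ys = refl
∑-filter-cartesianProductWith P? f g (x ∷ xs) ys = begin
  ∑ f (filter P? (List.map (g x) ys ++ zs))
    ≡⟨ cong (∑ f) (filter-++ P? (List.map (g x) ys) zs) ⟩
  ∑ f (filter P? (List.map (g x) ys) ++ filter P? zs)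
    ≡⟨ ∑-++ f (filter P? (List.map (g x) ys)) (filter P? zs) ⟩
  ∑ f (filter P? (List.map (g x) ys)) + ∑ f (filter P? zs)
    ≡⟨ cong₂ _+_ (∑-filter-map P? f (g x) ys) (∑-filter-cartesianProductWith P? f g xs ys) ⟩
  ∑ (f ∘ g x) (filter (P? ∘ g x) ys) + ∑ (λ x → ∑ (f ∘ g x) (filter (P? ∘ g x) ys)) xs ∎
  where
  open ≡-Reasoning
  zs = cartesianProductWith g xs ys

weight : ∀ {n} → (Fin n → ℕ) → Vec ℕ n → ℕ
weight d k = product (tabulate (λ i → multichoose (d i) (lookup k i)))

-- The recursion of `W` in terms of the differences of consecutive parts, with convolutions for
-- iterated partial sums.
V : ∀ n → (Fin n → ℕ) → ℕ → ℕ
V zero    d s = δ s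
V (suc n) d s = (multichoose (d zero) ⋆ V n (d ∘ suc)) (suc s)

-- Grouping the vectors by their first entry x gives a convolution: the rest has slack `suc s ∸ x`,
-- and x > s + 1 is impossible. The entries sum to s + n, so one cutoff b > s + n serves throughout
-- the recursion.
∑-InKˢ : ∀ n d s b → s + n < b → ∑ (weight d) (filter (inKˢ? s n) (vectorsBelow b n)) ≡ V n d s
∑-InKˢ zero    d zero    b _ = refl
∑-InKˢ zero    d (suc s) b _ = refl
∑-InKˢ (suc n) d s       b s+n<b = begin
  ∑ (weight d) (filter (inKˢ? s (suc n)) (vectorsBelow b (suc n)))
    ≡⟨ ∑-filter-cartesianProductWith (inKˢ? s (suc n)) (weight d) _∷_ (upTo b) (vectorsBelow b n) ⟩
  ∑ φ (upTo b)
    ≡⟨ cong sum (map-upTo φ b) ⟩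
  sum (applyUpTo φ b)
    ≡⟨ sum-applyUpTo-⋆ φ (multichoose (d zero)) (V n (d ∘ suc)) (suc s) b
         (≤-<-trans (≤-trans (s≤s (m≤m+n s n)) (≤-reflexive (sym (+-suc s n)))) s+n<b) φ≡ φ≡0 ⟩
  V (suc n) d s ∎
  where
  open ≡-Reasoning
  φ : ℕ → ℕ
  φ x = ∑ (weight d ∘ (x ∷_)) (filter (inKˢ? s (suc n) ∘ (x ∷_)) (vectorsBelow b n))
  bound : ∀ x → x ≤ suc s → suc s ∸ x + n < b
  bound x x≤ = ≤-<-trans (≤-trans (m≤n+m _ x) (≤-reflexive (slack-∷ n x≤))) s+n<b
  φ≡ : ∀ {x} → x ≤ suc s → φ x ≡ multichoose (d zero) x * V n (d ∘ suc) (suc s ∸ x)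
  φ≡ {x} x≤ = begin
    φ x
      ≡⟨ ∑-*ˡ (multichoose (d zero) x) (weight (d ∘ suc)) (filter (inKˢ? s (suc n) ∘ (x ∷_)) (vectorsBelow b n)) ⟩
    multichoose (d zero) x * ∑ (weight (d ∘ suc)) (filter (inKˢ? s (suc n) ∘ (x ∷_)) (vectorsBelow b n))
      ≡⟨ cong (λ ks → multichoose (d zero) x * ∑ (weight (d ∘ suc)) ks)
           (filter-≐ _ (inKˢ? (suc s ∸ x) n) (InKˢ-tail x≤ , InKˢ-∷ x≤) (vectorsBelow b n)) ⟩
    multichoose (d zero) x * ∑ (weight (d ∘ suc)) (filter (inKˢ? (suc s ∸ x) n) (vectorsBelow b n))
      ≡⟨ cong (multichoose (d zero) x *_) (∑-InKˢ n (d ∘ suc) (suc s ∸ x) b (bound x x≤)) ⟩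
    multichoose (d zero) x * V n (d ∘ suc) (suc s ∸ x) ∎
  φ≡0 : ∀ {x} → suc s < x → φ x ≡ 0
  φ≡0 {x} s<x = cong (∑ (weight d ∘ (x ∷_)))
    (filter-none (inKˢ? s (suc n) ∘ (x ∷_)) (All.universal (λ k k∈ → <⇒≱ s<x (InKˢ-head≤ k∈)) (vectorsBelow b n)))

difference : ∀ {n} → Vec ℕ n → Fin n → ℕ
difference μ i = lookup μ i ∸ lookup (μ ∷ʳ 0) (suc i)

-- Reconciles the `maxPart μ` subtracted in `W` with the convention λ_{n+1} = 0 of the theorem.
lookup-∷ʳ-0-maxPart : ∀ {n} {μ : Vec ℕ n} → IsPartition μ → lookup (μ ∷ʳ 0) zero ≡ maxPart μ
lookup-∷ʳ-0-maxPart {μ = []}    p = refl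
lookup-∷ʳ-0-maxPart {μ = _ ∷ _} p = sym (maxPart-∷ p)

W≗V : ∀ {n} {μ : Vec ℕ n} → IsPartition μ → W μ ≗ V n (difference μ)
W≗V {μ = []} p s = refl
W≗V {suc n} {a ∷ μ} p s = begin
  Σ≤^ (a ∸ maxPart μ) (W μ) (suc s)
    ≡⟨ Σ≤^≗multichoose-⋆ (a ∸ maxPart μ) (W μ) (suc s) ⟩
  (multichoose (a ∸ maxPart μ) ⋆ W μ) (suc s)
    ≡⟨ ⋆-congʳ (multichoose (a ∸ maxPart μ)) (W≗V (Linked.tail p)) (suc s) ⟩
  (multichoose (a ∸ maxPart μ) ⋆ V n (difference μ)) (suc s)
    ≡⟨ cong (λ h → (multichoose (a ∸ h) ⋆ V n (difference μ)) (suc s))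
         (lookup-∷ʳ-0-maxPart (Linked.tail p)) ⟨
  V (suc n) (difference (a ∷ μ)) s ∎
  where open ≡-Reasoning

-- At slack 0 `inKˢ?` computes to `inK?`, and `suc n` is the cutoff used in `K`.
W-∑K : ∀ n {μ : Vec ℕ n} → IsPartition μ → W μ 0 ≡ ∑K n (weight (difference μ))
W-∑K n {μ} p = trans (W≗V p 0) (sym (∑-InKˢ n (difference μ) 0 (suc n) ≤-refl))

-- Counting monomials

-- Cardinality is attached to predicates, so that one set can be counted by two lists whatever their
-- order.
record _HasSize_ {A : Set} (P : A → Set) (k : ℕ) : Set where
  constructor hasSize
  field
    elements : List A
    unique   : Unique elements
    ∈⇔       : ∀ {x} → x ∈ elements ⇔ P x
    size     : length elements ≡ k

open _HasSize_

module _ {A : Set} {P Q : A → Set} where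

  -- Duplicate-free lists with the same members are permutations of each other.
  HasSize-unique : ∀ {j k} → (∀ {x} → P x ⇔ Q x) → P HasSize j → Q HasSize k → j ≡ k
  HasSize-unique P⇔Q p q = begin
    _                   ≡⟨ size p ⟨
    length (elements p) ≡⟨ ↭-length (∼bag⇒↭ (unique∧set⇒bag (unique p) (unique q)
                             (⇔-sym (∈⇔ q) ⇔-∘ (P⇔Q ⇔-∘ ∈⇔ p)))) ⟩
    length (elements q) ≡⟨ size q ⟩
    _                   ∎
    where open ≡-Reasoning

  HasSize-resp-⇔ : ∀ {k} → (∀ {x} → P x ⇔ Q x) → P HasSize k → Q HasSize k
  HasSize-resp-⇔ P⇔Q p = hasSize (elements p) (unique p) (P⇔Q ⇔-∘ ∈⇔ p) (size p)

  HasSize-⊎ : ∀ {j k} → (∀ {x} → P x → ¬ Q x) → P HasSize j → Q HasSize k →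
    (λ x → P x ⊎ Q x) HasSize (j + k)
  HasSize-⊎ disjoint p q = hasSize
    (elements p ++ elements q)
    (Unique.++⁺ (unique p) (unique q) λ (∈p , ∈q) → disjoint (to (∈⇔ p) ∈p) (to (∈⇔ q) ∈q))
    (mk⇔ (Sum.map (to (∈⇔ p)) (to (∈⇔ q)) ∘ ∈-++⁻ (elements p))
         Sum.[ ∈-++⁺ˡ ∘ from (∈⇔ p) , ∈-++⁺ʳ (elements p) ∘ from (∈⇔ q) ])
    (trans (length-++ (elements p)) (cong₂ _+_ (size p) (size q)))

HasSize-image : ∀ {A B : Set} {P : A → Set} {k} {f : A → B} → Injective _≡_ _≡_ f →
  P HasSize k → (λ y → ∃ λ x → y ≡ f x × P x) HasSize k
HasSize-image {f = f} f-injective p = hasSize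
  (List.map f (elements p))
  (Unique.map⁺ f-injective (unique p))
  (mk⇔ (λ y∈ → let x , x∈ , y≡ = ∈-map⁻ f y∈ in x , y≡ , to (∈⇔ p) x∈)
       (λ (x , y≡ , px) → subst (_∈ _) (sym y≡) (∈-map⁺ f (from (∈⇔ p) px))))
  (trans (length-map f (elements p)) (size p))

-- Mon s μ α: x^α is a monomial of (x₁+⋯+x_m)ˢ Ω(μ) in the variables x₁,…,x_m.
data Mon {m} : ∀ {n} → ℕ → Vec ℕ n → Monomial m → Set where
  one  : Mon 0 [] (replicate m 0)
  free : ∀ {n s α} {μ : Vec ℕ n} i → Mon s μ α → Mon (suc s) μ (updateAt α i suc)
  part : ∀ {n a α} {μ : Vec ℕ n} i → toℕ i < a → Mon 0 μ α → Mon 0 (a ∷ μ) (updateAt α i suc)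

-- Monomials after adding a variable

private
  variable
    m n s : ℕ

∷ʳ-updateAt-inject₁ : ∀ (α : Vec ℕ m) i {x f} →
  updateAt (α ∷ʳ x) (inject₁ i) f ≡ updateAt α i f ∷ʳ x
∷ʳ-updateAt-inject₁ (a ∷ α) zero    = refl
∷ʳ-updateAt-inject₁ (a ∷ α) (suc i) = cong (a ∷_) (∷ʳ-updateAt-inject₁ α i)

lookup-∷ʳ-fromℕ : ∀ (α : Vec ℕ m) x → lookup (α ∷ʳ x) (fromℕ m) ≡ x
lookup-∷ʳ-fromℕ []      x = refl
lookup-∷ʳ-fromℕ (_ ∷ α) x = lookup-∷ʳ-fromℕ α x

updateAt-suc-injective : ∀ (i : Fin m) → Injective _≡_ _≡_ (λ (α : Monomial m) → updateAt α i suc)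
updateAt-suc-injective zero    {_ ∷ _} {_ ∷ _} eq =
  cong₂ _∷_ (suc-injective (proj₁ (∷-injective eq))) (proj₂ (∷-injective eq))
updateAt-suc-injective (suc i) {_ ∷ _} {_ ∷ _} eq =
  cong₂ _∷_ (proj₁ (∷-injective eq)) (updateAt-suc-injective i (proj₂ (∷-injective eq)))

replicate-∷ʳ : ∀ m → replicate (suc m) 0 ≡ replicate m 0 ∷ʳ 0
replicate-∷ʳ zero    = refl
replicate-∷ʳ (suc m) = cong (0 ∷_) (replicate-∷ʳ m)

-- This and `∃x·` are the two cases for the last variable: it is absent, or it is split off as a
-- factor.
∃∷ʳ0 : (Monomial m → Set) → Monomial (suc m) → Set
∃∷ʳ0 P β = ∃ λ α → β ≡ α ∷ʳ 0 × P α

∃x· : (Monomial (suc m) → Set) → Monomial (suc m) → Set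
∃x· P β = ∃ λ α → β ≡ updateAt α (fromℕ _) suc × P α

Mon-∷ʳ0 : ∀ {μ : Vec ℕ n} {α : Monomial m} → Mon s μ α → Mon s μ (α ∷ʳ 0)
Mon-∷ʳ0 {m = m} one = subst (Mon 0 []) (replicate-∷ʳ m) one
Mon-∷ʳ0 (free {α = α} i p) =
  subst (Mon _ _) (∷ʳ-updateAt-inject₁ α i) (free (inject₁ i) (Mon-∷ʳ0 p))
Mon-∷ʳ0 (part {α = α} i i<a p) = subst (Mon _ _) (∷ʳ-updateAt-inject₁ α i)
  (part (inject₁ i) (subst (_< _) (sym (toℕ-inject₁ i)) i<a) (Mon-∷ʳ0 p))

-- The last variable has index m, and every part is at most m, so no factor of Ω(μ) contains it.
Mon-zero⁻ : ∀ {μ : Vec ℕ n} {β} → maxPart μ ≤ m → Mon 0 μ β → ∃∷ʳ0 (Mon {m} 0 μ) β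
Mon-zero⁻ {m = m} _ one = replicate m 0 , replicate-∷ʳ m , one
Mon-zero⁻ {m = m} {a ∷ μ} μ≤m (part i i<a p)
  with α , refl , q ← Mon-zero⁻ (≤-trans (m≤n⊔m a _) μ≤m) p | view i
... | ‵fromℕ     = contradiction (≤-trans (m≤m⊔n a _) μ≤m) (<⇒≱ (subst (_< a) (toℕ-fromℕ m) i<a))
... | ‵inject₁ j = updateAt α j suc , ∷ʳ-updateAt-inject₁ α j , part j (subst (_< a) (toℕ-inject₁ j) i<a) q

-- If the last variable occurs, it comes from a free factor. Increments at different positions
-- commute, so that factor can be moved outermost.
Mon-suc⁻ : ∀ {μ : Vec ℕ n} {β} s → maxPart μ ≤ m → Mon (suc s) μ β →
  ∃∷ʳ0 (Mon {m} (suc s) μ) β ⊎ ∃x· (Mon s μ) β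
Mon-suc⁻ s μ≤m (free {α = γ} i p) with view i
Mon-suc⁻ s       μ≤m (free {α = γ} i p) | ‵fromℕ = inj₂ (γ , refl , p)
Mon-suc⁻ zero    μ≤m (free {α = γ} i p) | ‵inject₁ j
  with α , refl , q ← Mon-zero⁻ μ≤m p =
  inj₁ (updateAt α j suc , ∷ʳ-updateAt-inject₁ α j , free j q)
Mon-suc⁻ (suc s) μ≤m (free {α = γ} i p) | ‵inject₁ j with Mon-suc⁻ s μ≤m p
... | inj₁ (α , refl , q) = inj₁ (updateAt α j suc , ∷ʳ-updateAt-inject₁ α j , free j q)
... | inj₂ (α , refl , q) = inj₂
  (updateAt α (inject₁ j) suc , updateAt-commutes (inject₁ j) (fromℕ _) (fromℕ≢inject₁ ∘ sym) α , free (inject₁ j) q)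

module _ {n m} {μ : Vec ℕ n} {f : ℕ → ℕ} (μ≤m : maxPart μ ≤ m) (sizes : ∀ s → Mon {m} s μ HasSize f s) where

  -- Monomials without the last variable are counted by `f s`. From the others one factor of it is
  -- removed, which lowers the slack by one and keeps all m + 1 variables: this is the recursion of
  -- `Σ≤`.
  Mon-addVar : ∀ s → Mon {suc m} s μ HasSize Σ≤ f s
  Mon-addVar zero = HasSize-resp-⇔
    (mk⇔ (λ { (α , refl , p) → Mon-∷ʳ0 p }) (Mon-zero⁻ μ≤m))
    (HasSize-image (∷ʳ-injectiveˡ _ _) (sizes zero))
  Mon-addVar (suc s) = HasSize-resp-⇔
    (mk⇔ (λ { (inj₁ (α , refl , p)) → Mon-∷ʳ0 p
            ; (inj₂ (α , refl , p)) → free (fromℕ m) p })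
         (Mon-suc⁻ s μ≤m))
    (HasSize-⊎ disjoint
      (HasSize-image (∷ʳ-injectiveˡ _ _) (sizes (suc s)))
      (HasSize-image (updateAt-suc-injective (fromℕ m)) (Mon-addVar s)))
    where
    disjoint : ∀ {β} → ∃∷ʳ0 (Mon (suc s) μ) β → ¬ ∃x· (Mon s μ) β
    disjoint (α , refl , _) (γ , eq , _) = 0≢1+n (begin
      0                                          ≡⟨ lookup-∷ʳ-fromℕ α 0 ⟨
      lookup (α ∷ʳ 0) (fromℕ m)                  ≡⟨ cong (λ β → lookup β (fromℕ m)) eq ⟩
      lookup (updateAt γ (fromℕ m) suc) (fromℕ m) ≡⟨ lookup∘updateAt (fromℕ m) γ ⟩
      suc (lookup γ (fromℕ m))                   ∎)
      where open ≡-Reasoning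

Mon-addVars : ∀ {f : ℕ → ℕ} {μ : Vec ℕ n} → maxPart μ ≤ m → (∀ s → Mon {m} s μ HasSize f s) →
  ∀ d s → Mon {d + m} s μ HasSize Σ≤^ d f s
Mon-addVars μ≤m sizes zero    = sizes
Mon-addVars μ≤m sizes (suc d) = Mon-addVar (≤-trans μ≤m (m≤n+m _ d)) (Mon-addVars μ≤m sizes d)

module _ {a m} (m≤a : m ≤ a) where

  -- Since a ≥ m, the part a allows every variable, just as a free factor does. Free factors are
  -- outermost, so the innermost of them is the one exchanged for the part.
  Mon-free⇒part : ∀ {s} {μ : Vec ℕ n} {α : Monomial m} → Mon (suc s) μ α → Mon s (a ∷ μ) α
  Mon-free⇒part {s = zero}  (free i p) = part i (≤-trans (toℕ<n i) m≤a) p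
  Mon-free⇒part {s = suc s} (free i p) = free i (Mon-free⇒part p)

  Mon-part⇒free : ∀ {s} {μ : Vec ℕ n} {α : Monomial m} → Mon s (a ∷ μ) α → Mon (suc s) μ α
  Mon-part⇒free (free i p)   = free i (Mon-part⇒free p)
  Mon-part⇒free (part i _ p) = free i p

Mon-empty : ∀ s → Mon {0} s [] HasSize δ s
Mon-empty zero = hasSize ([] ∷ []) ([] ∷ []) (mk⇔ (λ { (here refl) → one }) (λ { one → here refl })) refl
Mon-empty (suc s) = hasSize [] [] (mk⇔ (λ ()) (λ { (free () _) })) refl

-- Variables are added until there are a of them, with slack `suc s`; then one free factor is
-- exchanged for the part a.
Mon-size : ∀ {n} {μ : Vec ℕ n} → IsPartition μ → ∀ s → Mon {maxPart μ} s μ HasSize W μ s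
Mon-size {μ = []}    p s = Mon-empty s
Mon-size {μ = a ∷ μ} p s rewrite maxPart-∷ p = HasSize-resp-⇔
  (mk⇔ (Mon-free⇒part ≤-refl) (Mon-part⇒free ≤-refl))
  (subst (λ m → Mon {m} (suc s) μ HasSize W (a ∷ μ) s) (m∸n+n≡m (maxPart≤ p))
    (Mon-addVars ≤-refl (Mon-size (Linked.tail p)) (a ∸ maxPart μ) (suc s)))

-- Formal sums without cancellation

exponents : Poly m → List (Monomial m)
exponents = List.map proj₂

-- Not the usual notion: every term of the formal sum has coefficient 1, so that terms cannot
-- cancel.
Monic : Poly m → Set
Monic = All ((1ℤ ≡_) ∘ proj₁)

coeff-monic : ∀ {p : Poly m} → Monic p → ∀ α → coeff p α ≡ ℤ.+ length (filter (λ t → proj₂ t ≟ᵐ α) p)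
coeff-monic [] α = refl
coeff-monic {p = (_ , β) ∷ _} (refl ∷ ps) α with β ≟ᵐ α
... | yes _ = cong (λ z → 1ℤ ℤ.+ z) (coeff-monic ps α)
... | no  _ = coeff-monic ps α

-- The coefficient is the number of terms with exponent α, and at least one is present.
coeff-monic≢0 : ∀ {p : Poly m} {α} → Monic p → α ∈ exponents p → coeff p α ≢ 0ℤ
coeff-monic≢0 {p = p} {α} ps α∈ eq
  with t , t∈ , refl ← ∈-map⁻ proj₂ α∈
  with filter (λ t → proj₂ t ≟ᵐ α) p | ∈-filter⁺ (λ t → proj₂ t ≟ᵐ α) t∈ refl | trans (sym (coeff-monic ps α)) eq
... | _ ∷ _ | _ | ()

support-size : ∀ {p : Poly m} → Monic p → (_∈ exponents p) HasSize #monomials p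
support-size {p = p} ps = hasSize (support p)
  (Unique.filter⁺ _ (deduplicate-! _≟ᵐ_ (exponents p)))
  (mk⇔ (∈-deduplicate⁻ _≟ᵐ_ (exponents p) ∘ proj₁ ∘ ∈-filter⁻ _)
       (λ α∈ → ∈-filter⁺ _ (∈-deduplicate⁺ _≟ᵐ_ α∈) (coeff-monic≢0 ps α∈)))
  refl

-- `Ω` ties the ring to the largest part, which can change when a part is removed; a fixed m permits
-- induction on μ.
Ωᵐ : ∀ m → Vec ℕ n → Poly m
Ωᵐ m μ = Vec.foldr′ _*ᵖ_ 1ᵖ (map x₁+⋯+x μ)

unit : Fin m → Monomial m
unit i = replicate _ 0 [ i ]≔ 1

unit-+ : ∀ (i : Fin m) α → zipWith _+_ (unit i) α ≡ updateAt α i suc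
unit-+ zero    (_ ∷ α) = cong (_ ∷_) (zipWith-identityˡ +-identityˡ α)
unit-+ (suc i) (a ∷ α) = cong (a ∷_) (unit-+ i α)

∈-x₁+⋯+x⁻ : ∀ {r} {t : ℤ × Monomial m} → t ∈ x₁+⋯+x r → ∃ λ i → toℕ i < r × t ≡ (1ℤ , unit i)
∈-x₁+⋯+x⁻ {m} {r} t∈
  with _ , t∈var , v∈ ← ∈-concat⁻′ (List.map var (filter (λ i → toℕ i <? r) (List.allFin m))) t∈
  with i , i∈ , refl ← ∈-map⁻ var v∈
  with here refl ← t∈var = i , proj₂ (∈-filter⁻ (λ i → toℕ i <? r) {xs = List.allFin m} i∈) , refl

∈-x₁+⋯+x⁺ : ∀ {r} {i : Fin m} → toℕ i < r → (1ℤ , unit i) ∈ x₁+⋯+x r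
∈-x₁+⋯+x⁺ {r = r} i<r =
  ∈-concat⁺′ (here refl) (∈-map⁺ var (∈-filter⁺ (λ i → toℕ i <? r) (∈-allFin _) i<r))

-- The coefficient is tracked along with the exponent because it rules out cancellation in `N≡W`.
∈-Ωᵐ⁻ : ∀ (μ : Vec ℕ n) {t} → t ∈ Ωᵐ m μ → 1ℤ ≡ proj₁ t × Mon 0 μ (proj₂ t)
∈-Ωᵐ⁻ []      (here refl) = refl , one
∈-Ωᵐ⁻ {m = m} (a ∷ μ) t∈
  with _ , (c , α) , u∈ , v∈ , refl ← ∈-cartesianProductWith⁻ _*ᵗ_ (x₁+⋯+x a) (Ωᵐ m μ) t∈
  with i , i<a , refl ← ∈-x₁+⋯+x⁻ {r = a} u∈
  with refl , p ← ∈-Ωᵐ⁻ μ v∈ = refl , subst (Mon 0 (a ∷ μ)) (sym (unit-+ i α)) (part i i<a p)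

∈-Ωᵐ⁺ : ∀ {μ : Vec ℕ n} {α} → Mon 0 μ α → (1ℤ , α) ∈ Ωᵐ m μ
∈-Ωᵐ⁺ one = here refl
∈-Ωᵐ⁺ {m = m} {a ∷ μ} (part {α = α} i i<a p) =
  subst (λ β → (1ℤ , β) ∈ Ωᵐ m (a ∷ μ)) (unit-+ i α)
    (∈-cartesianProductWith⁺ _*ᵗ_ (∈-x₁+⋯+x⁺ i<a) (∈-Ωᵐ⁺ p))

exponents-Ω : ∀ (μ : Vec ℕ n) {α} → α ∈ exponents (Ωᵐ m μ) ⇔ Mon 0 μ α
exponents-Ω μ = mk⇔
  (λ α∈ → let t , t∈ , α≡ = ∈-map⁻ proj₂ α∈ in subst (Mon 0 μ) (sym α≡) (proj₂ (∈-Ωᵐ⁻ μ t∈)))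
  (∈-map⁺ proj₂ ∘ ∈-Ωᵐ⁺)

-- The support of Ω(μ) and the enumeration built variable by variable list the same set of
-- exponents.
N≡W : ∀ {n} {μ : Vec ℕ n} → IsPartition μ → N n μ ≡ W μ 0
N≡W {μ = μ} p = HasSize-unique (exponents-Ω μ)
  (support-size (All.tabulate (proj₁ ∘ ∈-Ωᵐ⁻ μ))) (Mon-size p 0)

lemma4p1 : ∀ n (μ : Vec ℕ n) → IsPartition μ →
  (N n μ ≡ ∑K n (λ k → product (tabulate (λ i →
     multichoose (lookup μ i ∸ lookup (μ ∷ʳ 0) (suc i)) (lookup k i)))))
  × (∀ (i : Fin n) → IsPartition (updateAt μ i suc) →
     N n (updateAt μ i suc)
       ≡ N n μ
         + N (suc (toℕ i)) (map (λ a → a ∸ lookup μ i) (before μ i) ∷ʳ 1)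
           * N (n ∸ suc (toℕ i)) (after μ i))
lemma4p1 n μ p = trans (N≡W p) (W-∑K n p) , λ i q →
  trans (N≡W q) (trans (W-updateAt i p q)
    (cong₂ _+_ (sym (N≡W p))
      (cong₂ _*_ (sym (N≡W (cut-isPartition i p q))) (sym (N≡W (after-isPartition i p))))))
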